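{- Let $v,w\in S_n$ and let $\mathbf w$ be a reduced word for $w$. Then a $v$-subword $\mathbf v$ of $\mathbf w$ is anti-distinguished if and only if $\mathbf v^{\mathrm{rev}}$ is a distinguished $v^{ -1}$-subword of $\mathbf w^{\mathrm{rev}}$.
   Context: $S_n$ is the symmetric group with simple transpositions $s_1,\dots,s_{n-1}$, and $\le$ is the Bruhat order. A word is a finite sequence $\mathbf w=(s_{i_1},\dots,s_{i_m})$ of simple transpositions; it is a reduced word for $w$ if $w=s_{i_1}\cdots s_{i_m}$ and $m=\ell(w)$. A subword of $\mathbf w$ is a sequence $\mathbf v=(v_1,\dots,v_m)$ with $v_j\in\{s_{i_j},e\}$; it is a $v$-subword if $v_1\cdots v_m=v$. Put $\mathbf v_{(j)}=v_1\cdots v_j$ ($\mathbf v_{(0)}=e$) and $\mathbf v_{\langle j\rangle}=v_jv_{j+1}\cdots v_m$. A subword $\mathbf v$ of $\mathbf w$ is distinguished if $\mathbf v_{(j)}\le\mathbf v_{(j-1)}s_{i_j}$ for all $1\le j\le m$, and anti-distinguished if $\mathbf v_{\langle j\rangle}\le s_{i_j}\mathbf v_{\langle j+1\rangle}$ for all $1\le j\le m-1$. $\mathbf w^{\mathrm{rev}}=(s_{i_m},\dots,s_{i_1})$ and $\mathbf v^{\mathrm{rev}}=(v_m,\dots,v_1)$ denote reversed sequences. -}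

module Defs where

open import Data.Nat using (ℕ; suc; pred; _∸_; _≤_; _<_)
open import Data.Fin using (Fin; inject₁; toℕ)
open import Data.Fin.Permutation using (Permutation′; _≈_; id; _∘ₚ_; transpose)
open import Data.List as List using (List; foldr)
open import Data.Product using (_×_; ∃-syntax)
open import Data.Sum using (_⊎_)
open import Data.Vec using (Vec; lookup; map; toList)
open import Relation.Binary.PropositionalEquality using (_≢_)

-- The simple transposition exchanging i and i + 1.  The index set Fin (pred n)
-- is empty for n = 0 and n = 1.
simple : ∀ n → Fin (pred n) → Permutation′ n
simple (suc n) i = transpose (inject₁ i) (Fin.suc i)

module SymmetricGroup (n : ℕ) where

  S : Set
  S = Permutation′ n

  s : Fin (pred n) → S
  s = simple n

  -- Composition of functions: (u · w)(x) = u (w x), whereas _∘ₚ_ applies its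
  -- left argument first.
  infixl 7 _·_
  _·_ : S → S → S
  u · w = w ∘ₚ u

  product : List S → S
  product = foldr _·_ id

  -- A word is recorded by the indices of its letters.
  Word : ℕ → Set
  Word m = Vec (Fin (pred n)) m

  ⟦_⟧ : ∀ {m} → Word m → S
  ⟦ 𝐰 ⟧ = product (toList (map s 𝐰))

  -- ℓ(w) = k, where ℓ is the Coxeter length: the least number of simple
  -- transpositions in an expression for w.
  HasLength : S → ℕ → Set
  HasLength w k =
    (∃[ 𝐮 ] ⟦_⟧ {k} 𝐮 ≈ w) × (∀ {l} (𝐮 : Word l) → ⟦ 𝐮 ⟧ ≈ w → k ≤ l)

  IsReducedWord : S → ∀ {m} → Word m → Set
  IsReducedWord w {m} 𝐰 = ⟦ 𝐰 ⟧ ≈ w × HasLength w m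

  -- w = u t for a transposition t, and ℓ(u) < ℓ(w).
  infix 4 _⟶_ _≤ᴮ_
  _⟶_ : S → S → Set
  u ⟶ w =
    (∃[ i ] ∃[ j ] (i ≢ j × w ≈ u · transpose i j)) ×
    (∃[ k ] ∃[ l ] (HasLength u k × HasLength w l × k < l))

  -- Bruhat order: the reflexive transitive closure of _⟶_.  Reflexivity is up
  -- to _≈_, the equality of S.
  data _≤ᴮ_ : S → S → Set where
    ≈⇒≤ᴮ : ∀ {u w} → u ≈ w → u ≤ᴮ w
    step : ∀ {u x w} → u ⟶ x → x ≤ᴮ w → u ≤ᴮ w

  -- The candidates for subwords: sequences of elements of S.
  Seq : ℕ → Set
  Seq m = Vec S m

  IsSubword : ∀ {m} → Seq m → Word m → Set
  IsSubword 𝐯 𝐰 = ∀ j → lookup 𝐯 j ≈ s (lookup 𝐰 j) ⊎ lookup 𝐯 j ≈ id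

  IsSubwordFor : S → ∀ {m} → Seq m → Word m → Set
  IsSubwordFor v 𝐯 𝐰 = IsSubword 𝐯 𝐰 × product (toList 𝐯) ≈ v

  -- 𝐯 ₍ j ₎ = v₁ ⋯ vⱼ and 𝐯 ⟨ j ⟩ = vⱼ ⋯ vₘ, with positions counted from 1.
  -- An index j : Fin m stands for the position suc (toℕ j).
  _₍_₎ : ∀ {m} → Seq m → ℕ → S
  𝐯 ₍ j ₎ = product (List.take j (toList 𝐯))

  _⟨_⟩ : ∀ {m} → Seq m → ℕ → S
  𝐯 ⟨ j ⟩ = product (List.drop (j ∸ 1) (toList 𝐯))

  IsDistinguished : ∀ {m} → Seq m → Word m → Set
  IsDistinguished {m} 𝐯 𝐰 = ∀ (j : Fin m) →
    𝐯 ₍ suc (toℕ j) ₎ ≤ᴮ 𝐯 ₍ toℕ j ₎ · s (lookup 𝐰 j)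

  -- The condition suc (toℕ j) < m excludes the last position.
  IsAntiDistinguished : ∀ {m} → Seq m → Word m → Set
  IsAntiDistinguished {m} 𝐯 𝐰 = ∀ (j : Fin m) → suc (toℕ j) < m →
    𝐯 ⟨ suc (toℕ j) ⟩ ≤ᴮ s (lookup 𝐰 j) · 𝐯 ⟨ suc (suc (toℕ j)) ⟩

{-# OPTIONS --safe #-}

-- Inversion u ↦ u⁻¹ is an automorphism of the Bruhat order: it preserves length,
-- and w = u t gives w⁻¹ = u⁻¹ (u t u⁻¹), where u t u⁻¹ is again a transposition.
-- Since the letters are involutions, it carries the suffix 𝐯 ⟨ i ⟩ to a prefix of
-- the reversed sequence, and so each anti-distinguished condition to a
-- distinguished one.  The first distinguished condition of the reversed sequence
-- has no counterpart; it says vₘ ≤ sᵢₘ, which holds for every subword.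
module Submission where

open import Defs
open import Data.Nat using (ℕ; suc; _∸_; _≤_; z≤n; s≤s)
open import Data.Nat.Properties using (_<?_; 1+n≢n; +-∸-assoc; ≮⇒≥)
open import Data.Fin as Fin using (Fin; inject₁; fromℕ; toℕ; opposite)
open import Data.Fin.Properties using (_≟_; toℕ<n; toℕ-inject₁; opposite-prop; opposite-involutive)
open import Data.Fin.Permutation
  using (Permutation′; _≈_; _⟨$⟩ʳ_; _⟨$⟩ˡ_; id; flip; transpose; inverseˡ; inverseʳ)
import Data.Fin.Permutation.Components as PC
open import Data.List as List using (List; []; _∷_)
open import Data.List.Properties
  using (reverse-++; unfold-reverse; length-reverse; length-drop; take++drop≡id; drop-all)
open import Data.List.Relation.Unary.All using (All; []; _∷_)
open import Data.List.Relation.Unary.All.Properties using (drop⁺)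
open import Data.Product using (_×_; _,_; ∃-syntax)
open import Data.Sum using (_⊎_; inj₁; inj₂)
open import Data.Vec using (Vec; []; _∷_; _∷ʳ_; lookup; map; reverse; toList)
open import Data.Vec.Properties using (reverse-∷; map-reverse; toList-reverse; length-toList)
open import Data.Vec.Relation.Unary.All.Properties using (lookup⁻; toList⁺)
open import Function using (_∘_)
open import Function.Bundles using (_⇔_; mk⇔)
open import Relation.Binary.PropositionalEquality
open import Relation.Nullary using (Dec; ¬_; yes; no; contradiction)
open import Relation.Nullary.Decidable using (dec-true; dec-false)
open ≡-Reasoning

module _ {A : Set} where

  take-length-++ : (xs ys : List A) → List.take (List.length xs) (xs List.++ ys) ≡ xs
  take-length-++ []       ys = refl
  take-length-++ (x ∷ xs) ys = cong (x ∷_) (take-length-++ xs ys)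

  take-reverse : ∀ k (xs : List A) →
    List.take (List.length xs ∸ k) (List.reverse xs) ≡ List.reverse (List.drop k xs)
  take-reverse k xs = begin
    List.take (List.length xs ∸ k) (List.reverse xs)
      ≡⟨ cong₂ List.take length-suffix reverse-split ⟩
    List.take (List.length suffix) (suffix List.++ List.reverse (List.take k xs))
      ≡⟨ take-length-++ suffix _ ⟩
    suffix ∎
    where
    suffix = List.reverse (List.drop k xs)
    length-suffix : List.length xs ∸ k ≡ List.length suffix
    length-suffix = sym (trans (length-reverse (List.drop k xs)) (length-drop k xs))
    reverse-split : List.reverse xs ≡ suffix List.++ List.reverse (List.take k xs)
    reverse-split = trans (cong List.reverse (sym (take++drop≡id k xs)))
                          (reverse-++ (List.take k xs) (List.drop k xs))

  drop-toList : ∀ {m} (xs : Vec A m) (i : Fin m) →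
    List.drop (toℕ i) (toList xs) ≡ lookup xs i ∷ List.drop (suc (toℕ i)) (toList xs)
  drop-toList (x ∷ xs) Fin.zero    = refl
  drop-toList (x ∷ xs) (Fin.suc i) = drop-toList xs i

  lookup-∷ʳ-fromℕ : ∀ {m} (xs : Vec A m) x → lookup (xs ∷ʳ x) (fromℕ m) ≡ x
  lookup-∷ʳ-fromℕ []       x = refl
  lookup-∷ʳ-fromℕ (y ∷ xs) x = lookup-∷ʳ-fromℕ xs x

  lookup-∷ʳ-inject₁ : ∀ {m} (xs : Vec A m) x i → lookup (xs ∷ʳ x) (inject₁ i) ≡ lookup xs i
  lookup-∷ʳ-inject₁ (y ∷ xs) x Fin.zero    = refl
  lookup-∷ʳ-inject₁ (y ∷ xs) x (Fin.suc i) = lookup-∷ʳ-inject₁ xs x i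

  lookup-reverse : ∀ {m} (xs : Vec A m) i → lookup (reverse xs) (opposite i) ≡ lookup xs i
  lookup-reverse (x ∷ xs) Fin.zero =
    trans (cong (λ ys → lookup ys (fromℕ _)) (reverse-∷ x xs)) (lookup-∷ʳ-fromℕ (reverse xs) x)
  lookup-reverse (x ∷ xs) (Fin.suc i) = begin
    lookup (reverse (x ∷ xs)) (inject₁ (opposite i))
      ≡⟨ cong (λ ys → lookup ys (inject₁ (opposite i))) (reverse-∷ x xs) ⟩
    lookup (reverse xs ∷ʳ x) (inject₁ (opposite i))
      ≡⟨ lookup-∷ʳ-inject₁ (reverse xs) x (opposite i) ⟩
    lookup (reverse xs) (opposite i)
      ≡⟨ lookup-reverse xs i ⟩
    lookup xs i ∎

∀-opposite : ∀ {m} {P : Fin m → Set} → (∀ i → P (opposite i)) → ∀ j → P j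
∀-opposite {P = P} h j = subst P (opposite-involutive j) (h (opposite j))

suc-opposite : ∀ {m} (i : Fin m) → suc (toℕ (opposite i)) ≡ m ∸ toℕ i
suc-opposite i = trans (cong suc (opposite-prop i)) (sym (+-∸-assoc 1 (toℕ<n i)))

module _ {n : ℕ} where

  open SymmetricGroup n

  flip-cong : (π ρ : S) → π ≈ ρ → flip π ≈ flip ρ
  flip-cong π ρ π≈ρ x = begin
    π ⟨$⟩ˡ x                       ≡⟨ inverseˡ ρ ⟨
    ρ ⟨$⟩ˡ (ρ ⟨$⟩ʳ (π ⟨$⟩ˡ x))     ≡⟨ cong (ρ ⟨$⟩ˡ_) (π≈ρ (π ⟨$⟩ˡ x)) ⟨
    ρ ⟨$⟩ˡ (π ⟨$⟩ʳ (π ⟨$⟩ˡ x))     ≡⟨ cong (ρ ⟨$⟩ˡ_) (inverseʳ π) ⟩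
    ρ ⟨$⟩ˡ x                       ∎

  -- Transpositions

  transpose-matchˡ : ∀ (i j : Fin n) → PC.transpose i j i ≡ j
  transpose-matchˡ i j rewrite dec-true (i ≟ i) refl = refl

  transpose-matchʳ : ∀ (i j : Fin n) → PC.transpose i j j ≡ i
  transpose-matchʳ i j with j ≟ i
  ... | yes j≡i = j≡i
  ... | no  _ rewrite dec-true (j ≟ j) refl = refl

  transpose-mismatch : ∀ {i j k : Fin n} → k ≢ i → k ≢ j → PC.transpose i j k ≡ k
  transpose-mismatch {i} {j} {k} k≢i k≢j
    rewrite dec-false (k ≟ i) k≢i | dec-false (k ≟ j) k≢j = refl

  transpose-comm : (i j : Fin n) → transpose i j ≈ transpose j i
  transpose-comm i j k = by-cases (k ≟ i) (k ≟ j)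
    where
    by-cases : Dec (k ≡ i) → Dec (k ≡ j) → PC.transpose i j k ≡ PC.transpose j i k
    by-cases (yes refl) _          = trans (transpose-matchˡ k j) (sym (transpose-matchʳ j k))
    by-cases (no _)     (yes refl) = trans (transpose-matchʳ i k) (sym (transpose-matchˡ k i))
    by-cases (no k≢i)   (no k≢j)   =
      trans (transpose-mismatch k≢i k≢j) (sym (transpose-mismatch k≢j k≢i))

  transpose-involutive : ∀ (i j : Fin n) k → PC.transpose i j (PC.transpose i j k) ≡ k
  transpose-involutive i j k =
    trans (cong (PC.transpose i j) (transpose-comm i j k)) (PC.transpose-inverse i j)

  ⟨$⟩ʳ-injective : (u : S) {i j : Fin n} → u ⟨$⟩ʳ i ≡ u ⟨$⟩ʳ j → i ≡ j
  ⟨$⟩ʳ-injective u eq = trans (sym (inverseˡ u)) (trans (cong (u ⟨$⟩ˡ_) eq) (inverseˡ u))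

  ·-transpose : (u : S) (i j : Fin n) →
    u · transpose i j ≈ transpose (u ⟨$⟩ʳ i) (u ⟨$⟩ʳ j) · u
  ·-transpose u i j k = by-cases (k ≟ i) (k ≟ j)
    where
    by-cases : Dec (k ≡ i) → Dec (k ≡ j) →
      u ⟨$⟩ʳ PC.transpose i j k ≡ PC.transpose (u ⟨$⟩ʳ i) (u ⟨$⟩ʳ j) (u ⟨$⟩ʳ k)
    by-cases (yes refl) _ =
      trans (cong (u ⟨$⟩ʳ_) (transpose-matchˡ k j)) (sym (transpose-matchˡ (u ⟨$⟩ʳ k) (u ⟨$⟩ʳ j)))
    by-cases (no _) (yes refl) =
      trans (cong (u ⟨$⟩ʳ_) (transpose-matchʳ i k)) (sym (transpose-matchʳ (u ⟨$⟩ʳ i) (u ⟨$⟩ʳ k)))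
    by-cases (no k≢i) (no k≢j) =
      trans (cong (u ⟨$⟩ʳ_) (transpose-mismatch k≢i k≢j))
        (sym (transpose-mismatch (k≢i ∘ ⟨$⟩ʳ-injective u) (k≢j ∘ ⟨$⟩ʳ-injective u)))

  flip-·-transpose : (u w : S) (i j : Fin n) → w ≈ u · transpose i j →
    flip w ≈ flip u · transpose (u ⟨$⟩ʳ i) (u ⟨$⟩ʳ j)
  flip-·-transpose u w i j w≈ut x = sym (⟨$⟩ʳ-injective w (begin
    w ⟨$⟩ʳ (u ⟨$⟩ˡ t x)                     ≡⟨ w≈ut (u ⟨$⟩ˡ t x) ⟩
    u · transpose i j ⟨$⟩ʳ (u ⟨$⟩ˡ t x)     ≡⟨ ·-transpose u i j (u ⟨$⟩ˡ t x) ⟩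
    t (u ⟨$⟩ʳ (u ⟨$⟩ˡ t x))                 ≡⟨ cong t (inverseʳ u) ⟩
    t (t x)                                 ≡⟨ transpose-involutive (u ⟨$⟩ʳ i) (u ⟨$⟩ʳ j) x ⟩
    x                                       ≡⟨ inverseʳ w ⟨
    w ⟨$⟩ʳ (w ⟨$⟩ˡ x)                       ∎))
    where t = PC.transpose (u ⟨$⟩ʳ i) (u ⟨$⟩ʳ j)

  -- Products of involutions

  Involution : S → Set
  Involution π = π ≈ flip π

  product-++ : ∀ xs ys → product (xs List.++ ys) ≈ product xs · product ys
  product-++ []       ys k = refl
  product-++ (x ∷ xs) ys k = cong (x ⟨$⟩ʳ_) (product-++ xs ys k)

  product-reverse : ∀ {xs} → All Involution xs → product (List.reverse xs) ≈ flip (product xs)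
  product-reverse []                       k = refl
  product-reverse {x ∷ xs} (x-inv ∷ xs-inv) k = begin
    product (List.reverse (x ∷ xs)) ⟨$⟩ʳ k
      ≡⟨ cong (λ ys → product ys ⟨$⟩ʳ k) (unfold-reverse x xs) ⟩
    product (List.reverse xs List.∷ʳ x) ⟨$⟩ʳ k
      ≡⟨ product-++ (List.reverse xs) (x ∷ []) k ⟩
    product (List.reverse xs) ⟨$⟩ʳ (x ⟨$⟩ʳ k)
      ≡⟨ product-reverse xs-inv (x ⟨$⟩ʳ k) ⟩
    product xs ⟨$⟩ˡ (x ⟨$⟩ʳ k)
      ≡⟨ cong (product xs ⟨$⟩ˡ_) (x-inv k) ⟩
    product xs ⟨$⟩ˡ (x ⟨$⟩ˡ k) ∎

  product-toList-reverse : ∀ {m} (𝐯 : Seq m) → All Involution (toList 𝐯) →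
    product (toList (reverse 𝐯)) ≈ flip (product (toList 𝐯))
  product-toList-reverse 𝐯 inv k =
    trans (cong (λ xs → product xs ⟨$⟩ʳ k) (toList-reverse 𝐯)) (product-reverse inv k)

  prefix-reverse : ∀ {m} (𝐯 : Seq m) → All Involution (toList 𝐯) →
    ∀ k → reverse 𝐯 ₍ m ∸ k ₎ ≈ flip (𝐯 ⟨ suc k ⟩)
  prefix-reverse {m} 𝐯 inv k x = begin
    product (List.take (m ∸ k) (toList (reverse 𝐯))) ⟨$⟩ʳ x
      ≡⟨ cong (λ xs → product xs ⟨$⟩ʳ x) take≡ ⟩
    product (List.reverse (List.drop k (toList 𝐯))) ⟨$⟩ʳ x
      ≡⟨ product-reverse (drop⁺ k inv) x ⟩
    product (List.drop k (toList 𝐯)) ⟨$⟩ˡ x ∎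
    where
    take≡ : List.take (m ∸ k) (toList (reverse 𝐯)) ≡ List.reverse (List.drop k (toList 𝐯))
    take≡ = trans
      (cong₂ (λ l → List.take (l ∸ k)) (sym (length-toList 𝐯)) (toList-reverse 𝐯))
      (take-reverse k (toList 𝐯))

  -- Simple transpositions and length

  simple-transposition : ∀ a → ∃[ i ] ∃[ j ] (i ≢ j × s a ≈ transpose i j)
  simple-transposition a = lemma n a
    where
    lemma : ∀ n a → ∃[ i ] ∃[ j ] (i ≢ j × simple n a ≈ transpose i j)
    lemma (suc n) a = inject₁ a , Fin.suc a , distinct , λ _ → refl
      where
      distinct : inject₁ a ≢ Fin.suc a
      distinct eq = 1+n≢n (trans (sym (cong toℕ eq)) (toℕ-inject₁ a))

  s-involution : ∀ a → Involution (s a)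
  s-involution a k with simple-transposition a
  ... | i , j , _ , s≈t = begin
    s a ⟨$⟩ʳ k           ≡⟨ s≈t k ⟩
    PC.transpose i j k   ≡⟨ transpose-comm i j k ⟩
    PC.transpose j i k   ≡⟨ flip-cong (s a) (transpose i j) s≈t k ⟨
    s a ⟨$⟩ˡ k           ∎

  s≉id : ∀ a → ¬ s a ≈ id
  s≉id a s≈id with simple-transposition a
  ... | i , j , i≢j , s≈t =
    i≢j (trans (sym (s≈id i)) (trans (s≈t i) (transpose-matchˡ i j)))

  letters-involutive : ∀ {m} (𝐰 : Word m) → All Involution (toList (map s 𝐰))
  letters-involutive []       = []
  letters-involutive (a ∷ 𝐰) = s-involution a ∷ letters-involutive 𝐰

  subword-involutive : ∀ {m} (𝐯 : Seq m) (𝐰 : Word m) → IsSubword 𝐯 𝐰 →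
    All Involution (toList 𝐯)
  subword-involutive 𝐯 𝐰 sub = toList⁺ (lookup⁻ entry)
    where
    entry : ∀ i → Involution (lookup 𝐯 i)
    entry i k with sub i
    ... | inj₁ v≈s = trans (v≈s k) (trans (s-involution (lookup 𝐰 i) k)
                       (sym (flip-cong (lookup 𝐯 i) (s (lookup 𝐰 i)) v≈s k)))
    ... | inj₂ v≈id = trans (v≈id k) (sym (flip-cong (lookup 𝐯 i) id v≈id k))

  ⟦reverse⟧ : ∀ {m} (𝐰 : Word m) → ⟦ reverse 𝐰 ⟧ ≈ flip ⟦ 𝐰 ⟧
  ⟦reverse⟧ 𝐰 k = trans
    (cong (λ xs → product (toList xs) ⟨$⟩ʳ k) (map-reverse s 𝐰))
    (product-toList-reverse (map s 𝐰) (letters-involutive 𝐰) k)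

  HasLength-resp-≈ : ∀ u w {k} → u ≈ w → HasLength u k → HasLength w k
  HasLength-resp-≈ u w u≈w ((𝐮 , 𝐮≈u) , minimal) =
    (𝐮 , λ x → trans (𝐮≈u x) (u≈w x)) ,
    λ 𝐱 𝐱≈w → minimal 𝐱 (λ x → trans (𝐱≈w x) (sym (u≈w x)))

  HasLength-flip : ∀ w {k} → HasLength w k → HasLength (flip w) k
  HasLength-flip w ((𝐮 , 𝐮≈w) , minimal) =
    (reverse 𝐮 , λ x → trans (⟦reverse⟧ 𝐮 x) (flip-cong ⟦ 𝐮 ⟧ w 𝐮≈w x)) ,
    λ 𝐱 𝐱≈w⁻¹ → minimal (reverse 𝐱)
      (λ x → trans (⟦reverse⟧ 𝐱 x) (flip-cong ⟦ 𝐱 ⟧ (flip w) 𝐱≈w⁻¹ x))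

  HasLength-id : HasLength id 0
  HasLength-id = ([] , λ _ → refl) , λ _ _ → z≤n

  HasLength-s : ∀ a → HasLength (s a) 1
  HasLength-s a = (a ∷ [] , λ _ → refl) , minimal
    where
    minimal : ∀ {l} (𝐮 : Word l) → ⟦ 𝐮 ⟧ ≈ s a → 1 ≤ l
    minimal []      id≈s = contradiction (sym ∘ id≈s) (s≉id a)
    minimal (_ ∷ _) _    = s≤s z≤n

  -- Bruhat order

  ⟶-respˡ-≈ : ∀ u u′ w → u ≈ u′ → u ⟶ w → u′ ⟶ w
  ⟶-respˡ-≈ u u′ w u≈u′ ((i , j , i≢j , w≈ut) , (k , l , ℓu , ℓw , k<l)) =
    (i , j , i≢j , λ x → trans (w≈ut x) (u≈u′ (PC.transpose i j x))) ,
    (k , l , HasLength-resp-≈ u u′ u≈u′ ℓu , ℓw , k<l)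

  ≤ᴮ-resp-≈ : ∀ {u u′ w w′} → u ≈ u′ → w ≈ w′ → u ≤ᴮ w → u′ ≤ᴮ w′
  ≤ᴮ-resp-≈ u≈u′ w≈w′ (≈⇒≤ᴮ u≈w) =
    ≈⇒≤ᴮ (λ x → trans (sym (u≈u′ x)) (trans (u≈w x) (w≈w′ x)))
  ≤ᴮ-resp-≈ {u} {u′} u≈u′ w≈w′ (step {x = y} u⟶y y≤w) =
    step (⟶-respˡ-≈ u u′ y u≈u′ u⟶y) (≤ᴮ-resp-≈ {y} {y} (λ _ → refl) w≈w′ y≤w)

  ⟶-flip : ∀ u w → u ⟶ w → flip u ⟶ flip w
  ⟶-flip u w ((i , j , i≢j , w≈ut) , (k , l , ℓu , ℓw , k<l)) =
    (u ⟨$⟩ʳ i , u ⟨$⟩ʳ j , i≢j ∘ ⟨$⟩ʳ-injective u , flip-·-transpose u w i j w≈ut) ,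
    (k , l , HasLength-flip u ℓu , HasLength-flip w ℓw , k<l)

  ≤ᴮ-flip : ∀ {u w} → u ≤ᴮ w → flip u ≤ᴮ flip w
  ≤ᴮ-flip {u} {w} (≈⇒≤ᴮ u≈w)             = ≈⇒≤ᴮ (flip-cong u w u≈w)
  ≤ᴮ-flip {u}     (step {x = y} u⟶y y≤w) = step (⟶-flip u y u⟶y) (≤ᴮ-flip y≤w)

  id≤s : ∀ a → id ≤ᴮ s a
  id≤s a with simple-transposition a
  ... | i , j , i≢j , s≈t = step {x = s a}
    ((i , j , i≢j , s≈t) , (0 , 1 , HasLength-id , HasLength-s a , s≤s z≤n))
    (≈⇒≤ᴮ (λ _ → refl))

  -- Reversal of subwords

  module Reversal {m} (𝐯 : Seq m) (𝐰 : Word m) (sub : IsSubword 𝐯 𝐰) where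

    inv : All Involution (toList 𝐯)
    inv = subword-involutive 𝐯 𝐰 sub

    AntiDistinguishedAt DistinguishedAt : Fin m → Set
    AntiDistinguishedAt i = 𝐯 ⟨ suc (toℕ i) ⟩ ≤ᴮ s (lookup 𝐰 i) · 𝐯 ⟨ suc (suc (toℕ i)) ⟩
    DistinguishedAt j =
      reverse 𝐯 ₍ suc (toℕ j) ₎ ≤ᴮ reverse 𝐯 ₍ toℕ j ₎ · s (lookup (reverse 𝐰) j)

    lower-flip : ∀ i → reverse 𝐯 ₍ suc (toℕ (opposite i)) ₎ ≈ flip (𝐯 ⟨ suc (toℕ i) ⟩)
    lower-flip i k = trans (cong (λ l → reverse 𝐯 ₍ l ₎ ⟨$⟩ʳ k) (suc-opposite i))
                           (prefix-reverse 𝐯 inv (toℕ i) k)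

    upper-flip : ∀ i →
      reverse 𝐯 ₍ toℕ (opposite i) ₎ · s (lookup (reverse 𝐰) (opposite i)) ≈
      flip (s (lookup 𝐰 i) · 𝐯 ⟨ suc (suc (toℕ i)) ⟩)
    upper-flip i k = begin
      reverse 𝐯 ₍ toℕ (opposite i) ₎ · s (lookup (reverse 𝐰) (opposite i)) ⟨$⟩ʳ k
        ≡⟨ cong₂ (λ l a → reverse 𝐯 ₍ l ₎ · s a ⟨$⟩ʳ k) (opposite-prop i) (lookup-reverse 𝐰 i) ⟩
      reverse 𝐯 ₍ m ∸ suc (toℕ i) ₎ · s (lookup 𝐰 i) ⟨$⟩ʳ k
        ≡⟨ prefix-reverse 𝐯 inv (suc (toℕ i)) (s (lookup 𝐰 i) ⟨$⟩ʳ k) ⟩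
      𝐯 ⟨ suc (suc (toℕ i)) ⟩ ⟨$⟩ˡ (s (lookup 𝐰 i) ⟨$⟩ʳ k)
        ≡⟨ cong (𝐯 ⟨ suc (suc (toℕ i)) ⟩ ⟨$⟩ˡ_) (s-involution (lookup 𝐰 i) k) ⟩
      𝐯 ⟨ suc (suc (toℕ i)) ⟩ ⟨$⟩ˡ (s (lookup 𝐰 i) ⟨$⟩ˡ k) ∎

    anti⇒distinguished : ∀ i → AntiDistinguishedAt i → DistinguishedAt (opposite i)
    anti⇒distinguished i anti =
      ≤ᴮ-resp-≈ (sym ∘ lower-flip i) (sym ∘ upper-flip i) (≤ᴮ-flip anti)

    distinguished⇒anti : ∀ i → DistinguishedAt (opposite i) → AntiDistinguishedAt i
    distinguished⇒anti i dist =
      ≤ᴮ-resp-≈ {w′ = s (lookup 𝐰 i) · 𝐯 ⟨ suc (suc (toℕ i)) ⟩}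
        (flip-cong (reverse 𝐯 ₍ suc (toℕ (opposite i)) ₎) (flip (𝐯 ⟨ suc (toℕ i) ⟩)) (lower-flip i))
        (flip-cong (reverse 𝐯 ₍ toℕ (opposite i) ₎ · s (lookup (reverse 𝐰) (opposite i)))
          (flip (s (lookup 𝐰 i) · 𝐯 ⟨ suc (suc (toℕ i)) ⟩)) (upper-flip i))
        (≤ᴮ-flip dist)

    last-anti : ∀ i → m ≤ suc (toℕ i) → AntiDistinguishedAt i
    last-anti i m≤1+i = subst₂ (λ xs ys → product xs ≤ᴮ s (lookup 𝐰 i) · product ys)
      (sym (trans (drop-toList 𝐯 i) (cong (lookup 𝐯 i ∷_) suffix≡[]))) (sym suffix≡[])
      letter≤s
      where
      suffix≡[] : List.drop (suc (toℕ i)) (toList 𝐯) ≡ []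
      suffix≡[] = drop-all _ (toList 𝐯)
        (subst (_≤ suc (toℕ i)) (sym (length-toList 𝐯)) m≤1+i)
      letter≤s : product (lookup 𝐯 i ∷ []) ≤ᴮ s (lookup 𝐰 i) · id
      letter≤s with sub i
      ... | inj₁ v≈s  = ≈⇒≤ᴮ v≈s
      ... | inj₂ v≈id = ≤ᴮ-resp-≈ (sym ∘ v≈id) (λ _ → refl) (id≤s (lookup 𝐰 i))

    reverse-distinguished : IsAntiDistinguished 𝐯 𝐰 → IsDistinguished (reverse 𝐯) (reverse 𝐰)
    reverse-distinguished anti = ∀-opposite (λ i → anti⇒distinguished i (anti-everywhere i))
      where
      anti-everywhere : ∀ i → AntiDistinguishedAt i
      anti-everywhere i with suc (toℕ i) <? m
      ... | yes 1+i<m = anti i 1+i<m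
      ... | no  1+i≮m = last-anti i (≮⇒≥ 1+i≮m)

    reverse-subword : IsSubword (reverse 𝐯) (reverse 𝐰)
    reverse-subword = ∀-opposite (λ i →
      subst₂ (λ x a → x ≈ s a ⊎ x ≈ id) (sym (lookup-reverse 𝐯 i)) (sym (lookup-reverse 𝐰 i)) (sub i))

proposition6p1 : (n : ℕ) → let open SymmetricGroup n in
    (v w : Permutation′ n) {m : ℕ} (𝐰 : Word m) → IsReducedWord w 𝐰 →
    (𝐯 : Seq m) → IsSubwordFor v 𝐯 𝐰 →
    IsAntiDistinguished 𝐯 𝐰 ⇔
    (IsSubwordFor (flip v) (reverse 𝐯) (reverse 𝐰) × IsDistinguished (reverse 𝐯) (reverse 𝐰))
proposition6p1 n v w 𝐰 _ 𝐯 (sub , prod≈v) = mk⇔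
  (λ anti → (reverse-subword , reverse-product) , reverse-distinguished anti)
  (λ (_ , dist) i _ → distinguished⇒anti i (dist (opposite i)))
  where
  open SymmetricGroup n
  open Reversal 𝐯 𝐰 sub
  reverse-product : product (toList (reverse 𝐯)) ≈ flip v
  reverse-product k =
    trans (product-toList-reverse 𝐯 inv k) (flip-cong (product (toList 𝐯)) v prod≈v k)
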